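{- Let $n,d\ge 2$ and let $\mathcal{I}=(\mathcal{S},\mathcal{A})$ be a partial $2$-$(n^d,n,1)$-design such that, for every line $\ell$ and every point $P\notin\ell$, there are at most $\frac{n^d-1}{n-1}-n$ lines through $P$ that do not meet $\ell$. If at most one point of $\mathcal{I}$ has valency less than $\frac{n^d-1}{n-1}-1$, then $\mathcal{I}$ can be completed to a full $2$-$(n^d,n,1)$-design.
   Context: A $2$-$(v,k,1)$-design (respectively partial $2$-$(v,k,1)$-design) consists of a set $\mathcal{S}$ of $v$ points and a set $\mathcal{A}$ of $k$-element subsets of $\mathcal{S}$ (lines) such that every two distinct points lie in exactly (respectively at most) one line. A partial $2$-$(v,k,1)$-design $(\mathcal{S},\mathcal{A})$ can be completed to a full design if there is a $2$-$(v,k,1)$-design $(\mathcal{S},\mathcal{A}')$ with $\mathcal{A}\subseteq\mathcal{A}'$. The valency of a point is the number of lines containing it. -}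

module Defs where

open import Data.Fin.Base using (Fin)
open import Data.Fin.Subset using (Subset; _∈_; _∩_; ∣_∣; Empty)
open import Data.Fin.Subset.Properties using (_∈?_; nonempty?)
open import Data.List.Base using (List; filter; length)
open import Data.List.Membership.Propositional using () renaming (_∈_ to _∈ₗ_)
open import Data.List.Relation.Binary.Subset.Propositional using (_⊆_)
open import Data.List.Relation.Unary.Unique.Propositional using (Unique)
open import Data.Nat.Base using (ℕ; _≤_; _∸_; _^_; _/_; >-nonZero)
open import Data.Nat.Properties using (m<n⇒0<n∸m)
open import Data.Product using (_×_; ∃-syntax; ∃!)
open import Relation.Binary.PropositionalEquality.Core using (_≡_; _≢_)
open import Relation.Nullary.Decidable using (Dec; ¬?; _×-dec_)

-- A finite set of lines is a duplicate-free list of subsets of the point set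
-- Fin v, so that lengths of (filtered) lists are cardinalities.
record IsLineSet (v k : ℕ) (𝒜 : List (Subset v)) : Set where
  field
    unique : Unique 𝒜
    size   : ∀ {ℓ} → ℓ ∈ₗ 𝒜 → ∣ ℓ ∣ ≡ k

record IsPartialDesign (v k : ℕ) (𝒜 : List (Subset v)) : Set where
  field
    isLineSet : IsLineSet v k 𝒜
    atMostOne : ∀ {P Q : Fin v} → P ≢ Q → ∀ {ℓ m} →
                ℓ ∈ₗ 𝒜 → P ∈ ℓ → Q ∈ ℓ →
                m ∈ₗ 𝒜 → P ∈ m → Q ∈ m → ℓ ≡ m

  open IsLineSet isLineSet public

record IsDesign (v k : ℕ) (𝒜 : List (Subset v)) : Set where
  field
    isLineSet  : IsLineSet v k 𝒜
    exactlyOne : ∀ {P Q : Fin v} → P ≢ Q →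
                 ∃! _≡_ (λ ℓ → ℓ ∈ₗ 𝒜 × P ∈ ℓ × Q ∈ ℓ)

  open IsLineSet isLineSet public

Completable : (v k : ℕ) → List (Subset v) → Set
Completable v k 𝒜 = ∃[ 𝒜′ ] IsDesign v k 𝒜′ × 𝒜 ⊆ 𝒜′

module _ {v : ℕ} where

  valency : List (Subset v) → Fin v → ℕ
  valency 𝒜 P = length (filter (P ∈?_) 𝒜)

  MissesThrough : Fin v → Subset v → Subset v → Set
  MissesThrough P ℓ m = P ∈ m × Empty (m ∩ ℓ)

  missesThrough? : ∀ P ℓ m → Dec (MissesThrough P ℓ m)
  missesThrough? P ℓ m = P ∈? m ×-dec ¬? (nonempty? (m ∩ ℓ))

  missCount : List (Subset v) → Fin v → Subset v → ℕ
  missCount 𝒜 P ℓ = length (filter (missesThrough? P ℓ) 𝒜)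

-- (n ^ d - 1) / (n - 1) = 1 + n + ⋯ + n ^ (d - 1): the division is exact.
-- For d ≥ 2 the value is at least 1 + n, so subtracting 1 or n from it with ∸
-- does not truncate.
fullValency : (n d : ℕ) → 2 ≤ n → ℕ
fullValency n d 2≤n = ((n ^ d ∸ 1) / (n ∸ 1)) {{>-nonZero (m<n⇒0<n∸m 2≤n)}}

{-# OPTIONS --safe #-}

-- Let R = (n ^ d - 1) / (n - 1), and for a point P let N P be the set consisting
-- of P and the points not collinear with P.  A point of valency R has N P = {P};
-- one of valency R - 1 has ∣ N P ∣ = n.  Call P rich if its valency is at least
-- R - 1.  If a line ℓ not through a rich P contained two points of N P,
-- then at most n - 2 lines through P would meet ℓ, and the bound on the
-- lines missing ℓ would force the valency of P below R - 1.  So N P contains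
-- no two collinear points, and N P = N Q for rich P and Q with Q ∈ N P.
-- Adding the sets N P of size n for rich P as lines completes the design,
-- because of two non-collinear points one is rich.
module Submission where

open import Defs
open import Data.Bool.Base using (true; false)
open import Data.Bool.Properties using () renaming (_≟_ to _≟ᵇ_)
open import Data.Fin.Base using (Fin)
open import Data.Fin.Properties using () renaming (_≟_ to _≟ᶠ_)
open import Data.Fin.Subset
  using (Subset; inside; outside; _∈_; _∉_; _⊆_; _∩_; _∪_; _-_; ∁; ⋃; ⁅_⁆; ∣_∣; Empty; Nonempty)
open import Data.Fin.Subset.Properties
open import Data.List.Base
  using (List; []; _∷_; _++_; map; filter; length; allFin; deduplicate)
open import Data.List.Membership.Propositional using () renaming (_∈_ to _∈ₗ_)
open import Data.List.Membership.Propositional.Properties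
  using (∈-filter⁺; ∈-filter⁻; ∈-map⁺; ∈-map∘filter⁺; ∈-map∘filter⁻; ∈-allFin;
         ∈-++⁺ˡ; ∈-++⁺ʳ; ∈-++⁻; ∈-deduplicate⁺; ∈-deduplicate⁻)
open import Data.List.Properties using (length-map)
open import Data.List.Relation.Unary.All as All using (All; []; _∷_)
import Data.List.Relation.Unary.All.Properties as All
open import Data.List.Relation.Unary.AllPairs using (AllPairs; []; _∷_)
import Data.List.Relation.Unary.AllPairs.Properties as AllPairs
open import Data.List.Relation.Unary.Any using (here; there)
open import Data.List.Relation.Unary.Unique.Propositional using (Unique)
import Data.List.Relation.Unary.Unique.Propositional.Properties as Unique
import Data.List.Relation.Unary.Unique.DecPropositional.Properties as DecUnique
open import Data.Nat.Base hiding (∣_-_∣)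
open import Data.Nat.DivMod using (m*n/n≡m)
open import Data.Nat.Properties
open import Data.Nat.Tactic.RingSolver using (solve-∀)
open import Data.Product using (_×_; _,_; proj₂; ∃!; ∃-syntax)
open import Data.Sum.Base using (inj₁; inj₂; [_,_]′)
open import Data.Vec.Base using ([]; _∷_) renaming (here to hereᵛ; there to thereᵛ)
open import Data.Vec.Properties using (≡-dec)
open import Function.Base using (_∘_)
open import Relation.Binary.Core using (Rel)
open import Relation.Binary.Definitions using (DecidableEquality)
open import Relation.Binary.PropositionalEquality
  using (_≡_; _≢_; refl; sym; trans; cong; cong₂; subst; module ≡-Reasoning)
open import Relation.Nullary.Decidable using (yes; no; does; ¬?; _×-dec_)
open import Relation.Nullary.Negation using (¬_; contradiction)
open import Relation.Unary using (Pred; Decidable)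

-- Cardinalities of unions of pairwise disjoint subsets.

Disjoint : ∀ {v} → Rel (Subset v) _
Disjoint p q = Empty (p ∩ q)

∣p∪q∣≡∣p∣+∣q∣ : ∀ {v} (p q : Subset v) → Disjoint p q → ∣ p ∪ q ∣ ≡ ∣ p ∣ + ∣ q ∣
∣p∪q∣≡∣p∣+∣q∣ []            []            _   = refl
∣p∪q∣≡∣p∣+∣q∣ (outside ∷ p) (outside ∷ q) dis = ∣p∪q∣≡∣p∣+∣q∣ p q (drop-∷-Empty dis)
∣p∪q∣≡∣p∣+∣q∣ (outside ∷ p) (inside  ∷ q) dis =
  trans (cong suc (∣p∪q∣≡∣p∣+∣q∣ p q (drop-∷-Empty dis))) (sym (+-suc ∣ p ∣ ∣ q ∣))
∣p∪q∣≡∣p∣+∣q∣ (inside  ∷ p) (outside ∷ q) dis = cong suc (∣p∪q∣≡∣p∣+∣q∣ p q (drop-∷-Empty dis))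
∣p∪q∣≡∣p∣+∣q∣ (inside  ∷ p) (inside  ∷ q) dis = contradiction (_ , hereᵛ) dis

x∈p⇒1+∣p-x∣≡∣p∣ : ∀ {v} {x : Fin v} {p : Subset v} → x ∈ p → suc ∣ p - x ∣ ≡ ∣ p ∣
x∈p⇒1+∣p-x∣≡∣p∣ {p = inside ∷ p} hereᵛ = cong (suc ∘ ∣_∣) (p─⊥≡p p)
x∈p⇒1+∣p-x∣≡∣p∣ {p = outside ∷ _} (thereᵛ x∈p) = x∈p⇒1+∣p-x∣≡∣p∣ x∈p
x∈p⇒1+∣p-x∣≡∣p∣ {p = inside  ∷ _} (thereᵛ x∈p) = cong suc (x∈p⇒1+∣p-x∣≡∣p∣ x∈p)

-- Deleting a member lowers the cardinality, but deleting `x` a second time changes nothing.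
x∉p-x : ∀ {v} (x : Fin v) (p : Subset v) → x ∉ p - x
x∉p-x x p x∈p-x = <-irrefl refl
  (subst (λ q → ∣ q ∣ < ∣ p - x ∣) (p─q─q≡p─q p ⁅ x ⁆) (x∈p⇒∣p-x∣<∣p∣ x∈p-x))

x∈p-y⇒x≢y : ∀ {v} {x y : Fin v} (p : Subset v) → x ∈ p - y → x ≢ y
x∈p-y⇒x≢y p x∈p-y refl = x∉p-x _ p x∈p-y

x∈p-y⇒x∈p : ∀ {v} {x : Fin v} (p : Subset v) (y : Fin v) → x ∈ p - y → x ∈ p
x∈p-y⇒x∈p p y = p─q⊆p p ⁅ y ⁆

x∈p⇒∣p∣>0 : ∀ {v} {x : Fin v} {p : Subset v} → x ∈ p → 0 < ∣ p ∣
x∈p⇒∣p∣>0 x∈p = subst (0 <_) (x∈p⇒1+∣p-x∣≡∣p∣ x∈p) z<s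

x∈⋃⁺ : ∀ {v} {x : Fin v} {p} {ps : List (Subset v)} → p ∈ₗ ps → x ∈ p → x ∈ ⋃ ps
x∈⋃⁺ (here refl) x∈p = x∈p∪q⁺ (inj₁ x∈p)
x∈⋃⁺ (there p∈)  x∈p = x∈p∪q⁺ (inj₂ (x∈⋃⁺ p∈ x∈p))

x∈⋃⁻ : ∀ {v} {x : Fin v} (ps : List (Subset v)) → x ∈ ⋃ ps → ∃[ p ] p ∈ₗ ps × x ∈ p
x∈⋃⁻ []       x∈ = contradiction x∈ ∉⊥
x∈⋃⁻ (p ∷ ps) x∈ with x∈p∪q⁻ p (⋃ ps) x∈
... | inj₁ x∈p = p , here refl , x∈p
... | inj₂ x∈⋃ with q , q∈ , x∈q ← x∈⋃⁻ ps x∈⋃ = q , there q∈ , x∈q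

Disjoint-⋃ : ∀ {v} {p : Subset v} {ps} → All (Disjoint p) ps → Disjoint p (⋃ ps)
Disjoint-⋃ {p = p} {ps} dis (x , x∈) with x∈p , x∈⋃ ← x∈p∩q⁻ p (⋃ ps) x∈
  with q , q∈ , x∈q ← x∈⋃⁻ ps x∈⋃ = All.lookup dis q∈ (x , x∈p∩q⁺ (x∈p , x∈q))

∣⋃∣≡length* : ∀ {v} c {ps : List (Subset v)} → AllPairs Disjoint ps →
              All (λ p → ∣ p ∣ ≡ c) ps → ∣ ⋃ ps ∣ ≡ length ps * c
∣⋃∣≡length* {v} c []           []       = ∣⊥∣≡0 v
∣⋃∣≡length* c (dis ∷ diss) (∣p∣≡c ∷ all) =
  trans (∣p∪q∣≡∣p∣+∣q∣ _ _ (Disjoint-⋃ dis)) (cong₂ _+_ ∣p∣≡c (∣⋃∣≡length* c diss all))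

length≤∣⋃∣ : ∀ {v} {ps : List (Subset v)} → AllPairs Disjoint ps → All Nonempty ps →
             length ps ≤ ∣ ⋃ ps ∣
length≤∣⋃∣ []           []       = z≤n
length≤∣⋃∣ {ps = p ∷ ps} (dis ∷ diss) ((_ , x∈p) ∷ ne) =
  subst (suc (length ps) ≤_) (sym (∣p∪q∣≡∣p∣+∣q∣ p (⋃ ps) (Disjoint-⋃ dis)))
    (+-mono-≤ (x∈p⇒∣p∣>0 x∈p) (length≤∣⋃∣ diss ne))

Unique⇒AllPairs : ∀ {a r} {A : Set a} {R : Rel A r} {xs} → Unique xs →
                  (∀ {x y} → x ∈ₗ xs → y ∈ₗ xs → x ≢ y → R x y) → AllPairs R xs
Unique⇒AllPairs []         _ = []
Unique⇒AllPairs (x∉ ∷ uni) f =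
  All.tabulate (λ y∈ → f (here refl) (there y∈) (All.lookup x∉ y∈)) ∷
  Unique⇒AllPairs uni (λ x∈ y∈ → f (there x∈) (there y∈))

-- Needed to split the lines through a point into those missing a given line and those meeting it.
length-filter-split : ∀ {a p q} {A : Set a} {P : Pred A p} {Q : Pred A q}
  (P? : Decidable P) (Q? : Decidable Q) (xs : List A) →
  length (filter P? xs) ≡
  length (filter (λ x → P? x ×-dec ¬? (Q? x)) xs) + length (filter (λ x → P? x ×-dec Q? x) xs)
length-filter-split P? Q? [] = refl
length-filter-split P? Q? (x ∷ xs)
  with ih ← length-filter-split P? Q? xs | does (P? x) | does (Q? x)
... | false | _     = ih
... | true  | false = cong suc ih
... | true  | true  = trans (cong suc ih) (sym (+-suc _ _))

_≟ˢ_ : ∀ {v} → DecidableEquality (Subset v)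
_≟ˢ_ = ≡-dec _≟ᵇ_

-- Here k = n - 1.
module Completion
  {v k R : ℕ} {𝒜 : List (Subset v)} (v≡1+Rk : v ≡ suc (R * k)) (0<k : 0 < k) (k<R : k < R)
  (design : IsPartialDesign v (suc k) 𝒜)
  (missBound : ∀ ℓ → ℓ ∈ₗ 𝒜 → ∀ P → P ∉ ℓ → missCount 𝒜 P ℓ ≤ R ∸ suc k)
  (poorUnique : ∀ P Q → valency 𝒜 P < R ∸ 1 → valency 𝒜 Q < R ∸ 1 → P ≡ Q)
  where

  open IsPartialDesign design

  -- Rich points and the sets `N P`.

  Rich : Fin v → Set
  Rich P = R ∸ 1 ≤ valency 𝒜 P

  linesThrough : Fin v → List (Subset v)
  linesThrough P = filter (P ∈?_) 𝒜

  -- Deleting `P` from every line through it leaves pairwise disjoint pieces of `k` points, so that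
  -- the union can be counted.
  neighbours : Fin v → Subset v
  neighbours P = ⋃ (map (_- P) (linesThrough P))

  N : Fin v → Subset v
  N P = ∁ (neighbours P)

  ∈-neighbours⁻ : ∀ {P Q} → Q ∈ neighbours P → P ≢ Q × (∃[ ℓ ] ℓ ∈ₗ 𝒜 × P ∈ ℓ × Q ∈ ℓ)
  ∈-neighbours⁻ {P} {Q} Q∈ with p , p∈ , Q∈p ← x∈⋃⁻ (map (_- P) (linesThrough P)) Q∈
    with ℓ , ℓ∈ , refl , P∈ℓ ← ∈-map∘filter⁻ (_- P) (P ∈?_) p∈ =
    x∈p-y⇒x≢y ℓ Q∈p ∘ sym , ℓ , ℓ∈ , P∈ℓ , x∈p-y⇒x∈p ℓ P Q∈p

  ∈-neighbours⁺ : ∀ {P Q ℓ} → P ≢ Q → ℓ ∈ₗ 𝒜 → P ∈ ℓ → Q ∈ ℓ → Q ∈ neighbours P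
  ∈-neighbours⁺ {P} P≢Q ℓ∈ P∈ℓ Q∈ℓ =
    x∈⋃⁺ (∈-map⁺ (_- P) (∈-filter⁺ (P ∈?_) ℓ∈ P∈ℓ)) (x∈p∧x≢y⇒x∈p-y Q∈ℓ (P≢Q ∘ sym))

  ∈-N⁺ : ∀ {P Q} → (∀ {ℓ} → ℓ ∈ₗ 𝒜 → P ∈ ℓ → Q ∈ ℓ → P ≡ Q) → Q ∈ N P
  ∈-N⁺ f = x∉p⇒x∈∁p λ Q∈ → let P≢Q , ℓ , ℓ∈ , P∈ℓ , Q∈ℓ = ∈-neighbours⁻ Q∈ in
    P≢Q (f ℓ∈ P∈ℓ Q∈ℓ)

  ∈-N⁻ : ∀ {P Q ℓ} → Q ∈ N P → ℓ ∈ₗ 𝒜 → P ∈ ℓ → Q ∈ ℓ → P ≡ Q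
  ∈-N⁻ {P} {Q} Q∈N ℓ∈ P∈ℓ Q∈ℓ with P ≟ᶠ Q
  ... | yes P≡Q = P≡Q
  ... | no  P≢Q = contradiction (∈-neighbours⁺ P≢Q ℓ∈ P∈ℓ Q∈ℓ) (x∈∁p⇒x∉p Q∈N)

  N-refl : ∀ P → P ∈ N P
  N-refl P = ∈-N⁺ (λ _ _ _ → refl)

  N-sym : ∀ {P Q} → Q ∈ N P → P ∈ N Q
  N-sym Q∈N = ∈-N⁺ (λ ℓ∈ Q∈ℓ P∈ℓ → sym (∈-N⁻ Q∈N ℓ∈ P∈ℓ Q∈ℓ))

  ∣neighbours∣ : ∀ P → ∣ neighbours P ∣ ≡ valency 𝒜 P * k
  ∣neighbours∣ P = trans
    (∣⋃∣≡length* k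
      (AllPairs.map⁺ (Unique⇒AllPairs (Unique.filter⁺ (P ∈?_) unique) disjoint))
      (All.map⁺ (All.tabulate λ {ℓ} ℓ∈ → let ℓ∈𝒜 , P∈ℓ = ∈-filter⁻ (P ∈?_) ℓ∈ in
        suc-injective (trans (x∈p⇒1+∣p-x∣≡∣p∣ P∈ℓ) (size ℓ∈𝒜)))))
    (cong (_* k) (length-map (_- P) (linesThrough P)))
    where
    disjoint : ∀ {ℓ m} → ℓ ∈ₗ linesThrough P → m ∈ₗ linesThrough P → ℓ ≢ m →
               Disjoint (ℓ - P) (m - P)
    disjoint {ℓ} {m} ℓ∈ m∈ ℓ≢m (Q , Q∈)
      with ℓ∈𝒜 , P∈ℓ ← ∈-filter⁻ (P ∈?_) ℓ∈ | m∈𝒜 , P∈m ← ∈-filter⁻ (P ∈?_) m∈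
         | Q∈ℓ , Q∈m ← x∈p∩q⁻ (ℓ - P) (m - P) Q∈ =
      ℓ≢m (atMostOne (x∈p-y⇒x≢y ℓ Q∈ℓ ∘ sym)
        ℓ∈𝒜 P∈ℓ (x∈p-y⇒x∈p ℓ P Q∈ℓ) m∈𝒜 P∈m (x∈p-y⇒x∈p m P Q∈m))

  -- Complementary sets have sizes adding up to `v`; the additive form avoids truncated subtraction.
  ∣N∣+valency*k : ∀ P → ∣ N P ∣ + valency 𝒜 P * k ≡ suc (R * k)
  ∣N∣+valency*k P = begin
    ∣ N P ∣ + valency 𝒜 P * k                  ≡⟨ cong₂ _+_ (∣∁p∣≡n∸∣p∣ (neighbours P)) (sym (∣neighbours∣ P)) ⟩
    v ∸ ∣ neighbours P ∣ + ∣ neighbours P ∣   ≡⟨ m∸n+n≡m (∣p∣≤n (neighbours P)) ⟩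
    v                                        ≡⟨ v≡1+Rk ⟩
    suc (R * k)                              ∎
    where open ≡-Reasoning

  -- A second point in `N P` excludes valency `R`, and richness leaves only `R - 1`.
  Rich⇒∣N∣≡1+k : ∀ {P Q} → Rich P → P ≢ Q → Q ∈ N P → ∣ N P ∣ ≡ suc k
  Rich⇒∣N∣≡1+k {P} {Q} rich P≢Q Q∈N = +-cancelʳ-≡ (r * k) ∣ N P ∣ (suc k) (begin
    ∣ N P ∣ + r * k    ≡⟨ ∣N∣+valency*k P ⟩
    suc (R * k)        ≡⟨ cong (λ x → suc (x * k)) (sym 1+r≡R) ⟩
    suc k + r * k      ∎)
    where
    open ≡-Reasoning
    r = valency 𝒜 P

    1<∣N∣ : 1 < ∣ N P ∣
    1<∣N∣ = ≤-trans (s≤s (x∈p⇒∣p∣>0 (x∈p∧x≢y⇒x∈p-y Q∈N (P≢Q ∘ sym))))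
                    (x∈p⇒∣p-x∣<∣p∣ (N-refl P))

    r<R : r < R
    r<R = *-cancelʳ-< k r R
      (s<s⁻¹ (≤-trans (+-monoˡ-≤ (r * k) 1<∣N∣) (≤-reflexive (∣N∣+valency*k P))))

    1+r≡R : suc r ≡ R
    -- `R ≤ 1 + (R ∸ 1)` holds whether or not the subtraction truncates.
    1+r≡R = ≤-antisym r<R (≤-trans (m≤n+m∸n R 1) (s≤s rich))

  -- Non-collinearity within `N P`.

  N-coclique : ∀ {P Q Q′} → Rich P → Q ∈ N P → Q′ ∈ N P → Q′ ∈ N Q
  N-coclique {P} {Q} {Q′} rich Q∈N Q′∈N = ∈-N⁺ onLine
    where
    onLine : ∀ {ℓ} → ℓ ∈ₗ 𝒜 → Q ∈ ℓ → Q′ ∈ ℓ → Q ≡ Q′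
    onLine {ℓ} ℓ∈ Q∈ℓ Q′∈ℓ with Q ≟ᶠ Q′
    ... | yes Q≡Q′ = Q≡Q′
    ... | no  Q≢Q′ = contradiction rich (<⇒≱ poor)
      where
      P∉ℓ : P ∉ ℓ
      -- On a line through `P`, the only possible point of `N P` is `P` itself, so `Q` and `Q′`
      -- would both equal `P`.
      P∉ℓ P∈ℓ = Q≢Q′ (trans (sym (∈-N⁻ Q∈N ℓ∈ P∈ℓ Q∈ℓ)) (∈-N⁻ Q′∈N ℓ∈ P∈ℓ Q′∈ℓ))

      meets? : Decidable (λ m → P ∈ m × Nonempty (m ∩ ℓ))
      meets? m = P ∈? m ×-dec nonempty? (m ∩ ℓ)

      meeting = filter meets? 𝒜
      traces  = map (_∩ ℓ) meeting

      disjoint : ∀ {m m′} → m ∈ₗ meeting → m′ ∈ₗ meeting → m ≢ m′ →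
                 Disjoint (m ∩ ℓ) (m′ ∩ ℓ)
      disjoint {m} {m′} m∈ m′∈ m≢m′ (X , X∈)
        with m∈𝒜 , P∈m , _ ← ∈-filter⁻ meets? m∈ | m′∈𝒜 , P∈m′ , _ ← ∈-filter⁻ meets? m′∈
           | X∈mℓ , X∈m′ℓ ← x∈p∩q⁻ (m ∩ ℓ) (m′ ∩ ℓ) X∈
        with X∈m , X∈ℓ ← x∈p∩q⁻ m ℓ X∈mℓ | X∈m′ , _ ← x∈p∩q⁻ m′ ℓ X∈m′ℓ =
        -- A common point `X` of the traces lies on `ℓ`, hence differs from `P`, and then `m` and
        -- `m′` share two points.
        m≢m′ (atMostOne (λ { refl → P∉ℓ X∈ℓ }) m∈𝒜 P∈m X∈m m′∈𝒜 P∈m′ X∈m′)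

      ⋃traces⊆ : ⋃ traces ⊆ ℓ - Q - Q′
      ⋃traces⊆ {X} X∈ with p , p∈ , X∈p ← x∈⋃⁻ traces X∈
        with m , m∈𝒜 , refl , P∈m , _ ← ∈-map∘filter⁻ (_∩ ℓ) meets? p∈
        with X∈m , X∈ℓ ← x∈p∩q⁻ m ℓ X∈p =
        x∈p∧x≢y⇒x∈p-y (x∈p∧x≢y⇒x∈p-y X∈ℓ (avoids Q∈N Q∈ℓ)) (avoids Q′∈N Q′∈ℓ)
        where
        avoids : ∀ {Y} → Y ∈ N P → Y ∈ ℓ → X ≢ Y
        avoids Y∈N Y∈ℓ refl = P∉ℓ (subst (_∈ ℓ) (sym (∈-N⁻ Y∈N m∈𝒜 P∈m X∈m)) Y∈ℓ)

      open ≤-Reasoning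

      -- Lines through `P` have disjoint traces on `ℓ`, so at most one such line meets `ℓ` at each
      -- of its points; `Q` and `Q′` are met by none, which accounts for the 2.
      meeting-bound : 2 + length meeting ≤ suc k
      meeting-bound = begin
        2 + length meeting      ≡⟨ cong (2 +_) (length-map (_∩ ℓ) meeting) ⟨
        2 + length traces       ≤⟨ +-monoʳ-≤ 2 (length≤∣⋃∣
                                     (AllPairs.map⁺ (Unique⇒AllPairs (Unique.filter⁺ meets? unique) disjoint))
                                     (All.map⁺ (All.tabulate (proj₂ ∘ proj₂ ∘ ∈-filter⁻ meets? {xs = 𝒜})))) ⟩
        2 + ∣ ⋃ traces ∣        ≤⟨ +-monoʳ-≤ 2 (p⊆q⇒∣p∣≤∣q∣ ⋃traces⊆) ⟩
        2 + ∣ ℓ - Q - Q′ ∣      ≡⟨ cong suc (x∈p⇒1+∣p-x∣≡∣p∣ (x∈p∧x≢y⇒x∈p-y Q′∈ℓ (Q≢Q′ ∘ sym))) ⟩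
        1 + ∣ ℓ - Q ∣           ≡⟨ x∈p⇒1+∣p-x∣≡∣p∣ Q∈ℓ ⟩
        ∣ ℓ ∣                   ≡⟨ size ℓ∈ ⟩
        suc k                   ∎

      poor : valency 𝒜 P < R ∸ 1
      poor = s≤s⁻¹ (begin
        2 + valency 𝒜 P                            ≡⟨ cong (2 +_) (length-filter-split
                                                        (P ∈?_) (λ m → nonempty? (m ∩ ℓ)) 𝒜) ⟩
        2 + (missCount 𝒜 P ℓ + length meeting)     ≡⟨ shift (missCount 𝒜 P ℓ) (length meeting) ⟩
        missCount 𝒜 P ℓ + (2 + length meeting)     ≤⟨ +-mono-≤ (missBound ℓ ℓ∈ P P∉ℓ) meeting-bound ⟩
        -- Here `k < R` guarantees that the bound on missing lines is not truncated.
        R ∸ suc k + suc k                          ≡⟨ m∸n+n≡m k<R ⟩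
        R                                          ≤⟨ m≤n+m∸n R 1 ⟩
        suc (R ∸ 1)                                ∎)
        where
        shift : ∀ a b → 2 + (a + b) ≡ a + (2 + b)
        shift = solve-∀

  -- `N-coclique` at `P` is the inclusion of `N P` in `N Q`; the reverse one exchanges the two
  -- points.
  N-class : ∀ {P Q} → Rich P → Rich Q → Q ∈ N P → N P ≡ N Q
  N-class richP richQ Q∈N =
    ⊆-antisym (N-coclique richP Q∈N) (N-coclique richQ (N-sym Q∈N))

  -- The added lines and the enlarged line set.

  NewLineAt : Fin v → Set
  -- The size condition discards the points of valency `R`, where `N P` is a singleton.
  NewLineAt P = Rich P × ∣ N P ∣ ≡ suc k

  newLineAt? : Decidable NewLineAt
  newLineAt? P = (R ∸ 1 ≤? valency 𝒜 P) ×-dec (∣ N P ∣ ≟ suc k)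

  newLines : List (Subset v)
  -- By `N-class` all rich points of one class yield the same line.
  newLines = deduplicate _≟ˢ_ (map N (filter newLineAt? (allFin v)))

  ∈-newLines⁺ : ∀ {P} → NewLineAt P → N P ∈ₗ newLines
  ∈-newLines⁺ {P} new =
    ∈-deduplicate⁺ _≟ˢ_ (∈-map∘filter⁺ N newLineAt? {xs = allFin v} (P , ∈-allFin P , refl , new))

  ∈-newLines⁻ : ∀ {m} → m ∈ₗ newLines → ∃[ P ] m ≡ N P × NewLineAt P
  ∈-newLines⁻ m∈
    with P , _ , m≡ , new ← ∈-map∘filter⁻ N newLineAt? {xs = allFin v} (∈-deduplicate⁻ _≟ˢ_ _ m∈) =
    P , m≡ , new

  -- Only the point `O` that generates the line has to be rich; `P` and `Q` may be poor.
  newLine-coclique : ∀ {m P Q} → m ∈ₗ newLines → P ∈ m → Q ∈ m → Q ∈ N P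
  newLine-coclique m∈ P∈m Q∈m with O , refl , rich , _ ← ∈-newLines⁻ m∈ =
    N-coclique rich P∈m Q∈m

  newLine≡N : ∀ {m P} → Rich P → m ∈ₗ newLines → P ∈ m → m ≡ N P
  newLine≡N richP m∈ P∈m with O , refl , rich , _ ← ∈-newLines⁻ m∈ = N-class rich richP P∈m

  fullLines : List (Subset v)
  fullLines = 𝒜 ++ newLines

  isLineSet-full : IsLineSet v (suc k) fullLines
  isLineSet-full = record
    { unique = Unique.++⁺ unique (DecUnique.deduplicate-! _≟ˢ_ _) disjoint
    ; size   = λ ℓ∈ → [ size , newSize ]′ (∈-++⁻ 𝒜 ℓ∈)
    }
    where
    newSize : ∀ {m} → m ∈ₗ newLines → ∣ m ∣ ≡ suc k
    newSize m∈ with O , refl , _ , ∣N∣≡ ← ∈-newLines⁻ m∈ = ∣N∣≡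

    -- A line of size n ≥ 2 through O has a second point, which is collinear with O.
    disjoint : ∀ {m} → ¬ (m ∈ₗ 𝒜 × m ∈ₗ newLines)
    disjoint (m∈𝒜 , m∈) with O , refl , _ ← ∈-newLines⁻ m∈ = <⇒≢ 0<∣N-O∣ (sym ∣N-O∣≡0)
      where
      0<∣N-O∣ : 0 < ∣ N O - O ∣
      0<∣N-O∣ = s<s⁻¹
        (subst (1 <_) (trans (sym (size m∈𝒜)) (sym (x∈p⇒1+∣p-x∣≡∣p∣ (N-refl O)))) (s<s 0<k))

      ∣N-O∣≡0 : ∣ N O - O ∣ ≡ 0
      ∣N-O∣≡0 = trans
        (cong ∣_∣ (Empty-unique {p = N O - O} λ (X , X∈) →
          let X∈N = x∈p-y⇒x∈p (N O) O X∈ in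
          x∈p-y⇒x≢y (N O) X∈ (sym (∈-N⁻ X∈N m∈𝒜 (N-refl O) X∈N))))
        (∣⊥∣≡0 v)

  -- Every two distinct points lie on exactly one line.

  JoinedOnce : Fin v → Fin v → Set
  JoinedOnce P Q = ∃! _≡_ (λ ℓ → ℓ ∈ₗ fullLines × P ∈ ℓ × Q ∈ ℓ)

  JoinedOnce-sym : ∀ {P Q} → JoinedOnce P Q → JoinedOnce Q P
  JoinedOnce-sym (ℓ , (ℓ∈ , P∈ℓ , Q∈ℓ) , uni) =
    ℓ , (ℓ∈ , Q∈ℓ , P∈ℓ) , λ (m∈ , Q∈m , P∈m) → uni (m∈ , P∈m , Q∈m)

  joinCollinear : ∀ {P Q} → Q ∈ neighbours P → JoinedOnce P Q
  joinCollinear {P} {Q} Q∈ with P≢Q , ℓ , ℓ∈ , P∈ℓ , Q∈ℓ ← ∈-neighbours⁻ Q∈ =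
    ℓ , (∈-++⁺ˡ ℓ∈ , P∈ℓ , Q∈ℓ) , λ (m∈ , P∈m , Q∈m) →
      [ (λ m∈𝒜 → atMostOne P≢Q ℓ∈ P∈ℓ Q∈ℓ m∈𝒜 P∈m Q∈m)
      -- A new line contains no two collinear points.
      , (λ m∈new → contradiction Q∈ (x∈∁p⇒x∉p (newLine-coclique m∈new P∈m Q∈m)))
      ]′ (∈-++⁻ 𝒜 m∈)

  joinNonCollinear : ∀ {P Q} → Rich P → P ≢ Q → Q ∈ N P → JoinedOnce P Q
  joinNonCollinear {P} rich P≢Q Q∈N =
    N P , (∈-++⁺ʳ 𝒜 (∈-newLines⁺ (rich , Rich⇒∣N∣≡1+k rich P≢Q Q∈N)) , N-refl P , Q∈N) ,
    λ (m∈ , P∈m , Q∈m) →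
      [ (λ m∈𝒜 → contradiction (∈-N⁻ Q∈N m∈𝒜 P∈m Q∈m) P≢Q)
      , (λ m∈new → sym (newLine≡N rich m∈new P∈m))
      ]′ (∈-++⁻ 𝒜 m∈)

  joinedOnce : ∀ {P Q} → P ≢ Q → JoinedOnce P Q
  joinedOnce {P} {Q} P≢Q with Q ∈? neighbours P
  ... | yes Q∈ = joinCollinear Q∈
  ... | no  Q∉ with R ∸ 1 ≤? valency 𝒜 P | R ∸ 1 ≤? valency 𝒜 Q
  ...   | yes rich | _        = joinNonCollinear rich P≢Q (x∉p⇒x∈∁p Q∉)
  -- With only `Q` known to be rich, the joining line is `N Q`, so the roles are exchanged.
  ...   | no  _    | yes rich =
    JoinedOnce-sym (joinNonCollinear rich (P≢Q ∘ sym) (N-sym (x∉p⇒x∈∁p Q∉)))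
  ...   | no  ¬P   | no  ¬Q   = contradiction (poorUnique P Q (≰⇒> ¬P) (≰⇒> ¬Q)) P≢Q

  completable : Completable v (suc k) 𝒜
  completable = fullLines , record { isLineSet = isLineSet-full ; exactlyOne = joinedOnce } , ∈-++⁺ˡ

-- The geometric sum and the instantiation of the parameters.

geometricSum : ℕ → ℕ → ℕ
geometricSum n zero    = 0
geometricSum n (suc d) = 1 + n * geometricSum n d

-- The subtraction-free form serves twice: it gives the point count `1 + R * k` and shows that the
-- division in `fullValency` is exact.
[1+k]^d≡1+geometricSum*k : ∀ k d → suc k ^ d ≡ suc (geometricSum (suc k) d * k)
[1+k]^d≡1+geometricSum*k k zero    = refl
[1+k]^d≡1+geometricSum*k k (suc d) = begin
  suc k * suc k ^ d        ≡⟨ cong (suc k *_) ([1+k]^d≡1+geometricSum*k k d) ⟩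
  suc k * suc (s * k)      ≡⟨ expand k s ⟩
  suc ((1 + suc k * s) * k) ∎
  where
  open ≡-Reasoning
  s = geometricSum (suc k) d

  expand : ∀ k s → suc k * suc (s * k) ≡ suc ((1 + suc k * s) * k)
  expand = solve-∀

fullValency≡geometricSum : ∀ n d (2≤n : 2 ≤ n) → fullValency n d 2≤n ≡ geometricSum n d
fullValency≡geometricSum (suc k) d 2≤n
  rewrite [1+k]^d≡1+geometricSum*k k d =
  m*n/n≡m (geometricSum (suc k) d) k {{>-nonZero (m<n⇒0<n∸m 2≤n)}}

n<geometricSum : ∀ n d → 2 ≤ d → n < geometricSum n d
n<geometricSum n (suc (suc d)) _ = s≤s (m≤m*n n (suc (n * geometricSum n d)))
n<geometricSum n (suc zero) (s≤s ())

lemma2 : (n d : ℕ) (2≤n : 2 ≤ n) → 2 ≤ d →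
    (𝒜 : List (Subset (n ^ d))) → IsPartialDesign (n ^ d) n 𝒜 →
    (∀ ℓ → ℓ ∈ₗ 𝒜 → ∀ P → P ∉ ℓ →
    missCount 𝒜 P ℓ ≤ fullValency n d 2≤n ∸ n) →
    ((P Q : Fin (n ^ d)) →
    valency 𝒜 P < fullValency n d 2≤n ∸ 1 →
    valency 𝒜 Q < fullValency n d 2≤n ∸ 1 → P ≡ Q) →
    Completable (n ^ d) n 𝒜
lemma2 (suc k) d 2≤n 2≤d 𝒜 design missBound poorUnique =
  Completion.completable
    (trans ([1+k]^d≡1+geometricSum*k k d) (cong (λ r → suc (r * k)) (sym R≡)))
    (s≤s⁻¹ 2≤n)
    -- The assumption `2 ≤ d` enters here, through `k < n < R`.
    (subst (k <_) (sym R≡) (<-trans (n<1+n k) (n<geometricSum (suc k) d 2≤d)))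
    design missBound poorUnique
  where
  R≡ = fullValency≡geometricSum (suc k) d 2≤n
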